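{- For every even integer $m\geq 4$ and every integer $k\geq 2$, there exists a $k$-chromatic $P_m$ system (of some order $n>1$).
   Context: $P_m=(a_1,\ldots,a_m)$ denotes the path on $m$ distinct vertices $a_1,\ldots,a_m$ with edges $\{a_i,a_{i+1}\}$, $1\leq i\leq m-1$. A $P_m$ system of order $n>1$ is a pair $(V,\mathcal B)$ where $V$ is a set of $n$ vertices and $\mathcal B$ is a set of $P_m$ paths with vertices in $V$ whose edge sets partition the edge set of the complete graph on $V$. A $k$-colouring of $(V,\mathcal B)$ is a partition of $V$ into $k$ (possibly empty) colour classes such that no path in $\mathcal B$ is monochromatic (i.e. has all its vertices in the same class). The system is $k$-colourable if it has a $k$-colouring, and $k$-chromatic if it is $k$-colourable but not $(k-1)$-colourable. -}

module Defs where

open import Data.Fin.Base using (Fin; toℕ)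
open import Data.Nat.Base using (ℕ; suc; _∸_)
open import Data.Product using (∃; ∃-syntax; ∃₂; ∃!; _×_)
open import Data.Sum.Base using (_⊎_)
open import Function.Definitions using (Injective)
open import Relation.Binary.PropositionalEquality using (_≡_; _≢_)
open import Relation.Nullary.Negation using (¬_)

-- The path (a₁,…,aₘ) on m distinct vertices of an n-set; a₁ is vertex zero.
record Path (m n : ℕ) : Set where
  field
    vertex   : Fin m → Fin n
    distinct : Injective _≡_ _≡_ vertex

open Path public

-- {u , v} is one of the edges {aᵢ , aᵢ₊₁} of P, regardless of orientation.
HasEdge : ∀ {m n} → Path m n → Fin n → Fin n → Set
HasEdge P u v = ∃₂ λ i j → toℕ j ≡ suc (toℕ i) ×
  ((vertex P i ≡ u × vertex P j ≡ v) ⊎ (vertex P i ≡ v × vertex P j ≡ u))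

-- The set of paths is given by an enumeration.  For m ≥ 2 every path has an
-- edge, so uniqueness in `partition` makes the enumerated paths pairwise
-- distinct, even up to reversal.  A path has only edges {u , v} with u ≢ v
-- (its vertices are distinct), so `partition` says exactly that the edge sets
-- partition the edge set of the complete graph on Fin n.
record PathSystem (m n : ℕ) : Set where
  field
    size      : ℕ
    path      : Fin size → Path m n
    partition : ∀ u v → u ≢ v → ∃! _≡_ λ b → HasEdge (path b) u v

open PathSystem public

Monochromatic : ∀ {m n k} → (Fin n → Fin k) → Path m n → Set
Monochromatic colour P = ∃[ c ] (∀ i → colour (vertex P i) ≡ c)

-- Classes are the fibres of a map to Fin k, which need not be surjective:
-- colour classes may be empty.
IsColouring : ∀ {m n} → PathSystem m n → (k : ℕ) → (Fin n → Fin k) → Set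
IsColouring S k colour = ∀ b → ¬ Monochromatic colour (path S b)

Colourable : ∀ {m n} → ℕ → PathSystem m n → Set
Colourable k S = ∃ (IsColouring S k)

-- Meant for k ≥ 1 only, where ∸ is true subtraction.
Chromatic : ∀ {m n} → ℕ → PathSystem m n → Set
Chromatic k S = Colourable k S × ¬ Colourable (k ∸ 1) S

{-# OPTIONS --safe #-}
module Submission where

-- Let m = 2h and s = m − 1.
--
-- Any set Q of edge-disjoint m-paths on a set W extends to a P_m system on
-- ∞ and W × ℤ/s: each group w × ℤ/s together with ∞ is a K_m, decomposed into
-- h Hamiltonian paths; the edges between two groups w, w′ form a K_{s,s}, which
-- is decomposed into s zigzag paths if ww′ lies on no path of Q; and for each
-- path of Q the edges between consecutive groups along it are decomposed into
-- the s² paths through these groups whose second coordinates alternate between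
-- two values x, y.  For x = y = 0 these are copies of the paths of Q, so the
-- system needs at least as many colours as Q.
--
-- Removing a path b from Q lowers the chromatic number of the system by at most
-- one: recolour the group of an end of b with a new colour, which is safe
-- because no path, having m > s vertices, lies within a group.  For Q = ∅ the
-- system is 2-colourable, so removing paths one by one from a Q that is not
-- (k − 1)-colourable passes through a k-chromatic system.
--
-- A set Q that is not (k + 1)-colourable comes from copies of a V that is not
-- k-colourable: each copy contains a vertex of colour 0, and it suffices to add
-- edge-disjoint paths across the copies so that every choice of one vertex from
-- each copy contains one of them.

open import Defs
open import Data.Nat.Base using (ℕ; _≥_; _>_)
open import Data.Nat.Divisibility using (_∣_)
open import Data.Product using (∃-syntax; Σ-syntax; _×_)

open import Algebra.Bundles using (AbelianGroup)
import Algebra.Properties.AbelianGroup as AbelianGroupProperties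
import Algebra.Properties.CommutativeSemigroup as CommutativeSemigroupProperties
open import Data.Empty using (⊥-elim-irr)
open import Data.Fin.Base as Fin using (Fin; zero; suc; toℕ; fromℕ<; inject≤; punchOut; finToFun; funToFin)
open import Data.Fin.Properties as Fin using (toℕ<n; toℕ-fromℕ<; toℕ-injective; any?; all?; +↔⊎; *↔×; finToFun-funToFin; punchIn-punchOut; <⇒notInjective; inject≤-injective)
open import Data.Irrelevant using ([_])
open import Data.Maybe.Base using (Maybe; just; nothing)
open import Data.Maybe.Properties using (just-injective)
open import Data.Nat.Base hiding (parity)
open import Data.Nat.Divisibility using (divides)
open import Data.Nat.DivMod
open import Data.Nat.Properties
open import Data.Product as Product using (∃; ∃₂; ∃!; _,_; proj₁; proj₂)
open import Data.Product.Function.NonDependent.Propositional using (_×-↔_)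
open import Data.Product.Properties using (,-injectiveʳ)
open import Data.Refinement.Base using (Refinement; value; _,_; refine)
open import Data.Refinement.Properties using (value-injective)
open import Data.Sum as Sum using (_⊎_; inj₁; inj₂)
open import Data.Sum.Function.Propositional using (_⊎-↔_)
open import Data.Sum.Properties using (inj₁-injective)
open import Function.Base using (_∘_; id)
open import Function.Bundles using (_↔_; Injection; Inverse; mk↔ₛ′)
open import Function.Definitions using (Injective)
open import Function.Properties.Inverse using (↔-refl; ↔-sym; ↔-trans; ↔⇒↣)
open import Level using (0ℓ)
open import Relation.Binary.Definitions using (tri<; tri≈; tri>)
open import Relation.Binary.PropositionalEquality hiding (J; [_])
open import Relation.Nullary
open import Relation.Nullary.Decidable using (_×-dec_; _⊎-dec_; ¬?)

-- Arithmetic in the cyclic group of order n + 1.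

module Cyclic (n : ℕ) where
  open ≡-Reasoning

  -- Opaque outside this block: residues are handled only through the laws proved in it, never by
  -- unfolding the remainder.
  abstract
    ι : ℕ → Fin (suc n)
    ι a = a mod suc n

    toℕ-ι : ∀ a → toℕ (ι a) ≡ a % suc n
    toℕ-ι a = toℕ-fromℕ< (m%n<n a (suc n))

    toℕ-ι-< : ∀ {a} → a < suc n → toℕ (ι a) ≡ a
    toℕ-ι-< {a} a<N = trans (toℕ-ι a) (m<n⇒m%n≡m a<N)

    ι-toℕ : ∀ x → ι (toℕ x) ≡ x
    ι-toℕ x = toℕ-injective (toℕ-ι-< (toℕ<n x))

    ι-injective : ∀ {a b} → a < suc n → b < suc n → ι a ≡ ι b → a ≡ b
    ι-injective a< b< eq = trans (sym (toℕ-ι-< a<)) (trans (cong toℕ eq) (toℕ-ι-< b<))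

    infixl 6 _⊕_
    _⊕_ : Fin (suc n) → Fin (suc n) → Fin (suc n)
    x ⊕ y = ι (toℕ x + toℕ y)

    ⊖_ : Fin (suc n) → Fin (suc n)
    ⊖ x = ι (suc n ∸ toℕ x)

    ι-+ : ∀ a b → ι (a + b) ≡ ι a ⊕ ι b
    ι-+ a b = toℕ-injective (begin
      toℕ (ι (a + b))                            ≡⟨ toℕ-ι (a + b) ⟩
      (a + b) % suc n                            ≡⟨ %-distribˡ-+ a b (suc n) ⟩
      (a % suc n + b % suc n) % suc n            ≡⟨ cong₂ (λ x y → (x + y) % suc n) (toℕ-ι a) (toℕ-ι b) ⟨
      (toℕ (ι a) + toℕ (ι b)) % suc n            ≡⟨ toℕ-ι (toℕ (ι a) + toℕ (ι b)) ⟨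
      toℕ (ι a ⊕ ι b)                            ∎)

    ι-N : ι (suc n) ≡ ι 0
    ι-N = toℕ-injective (trans (toℕ-ι (suc n)) (trans (n%n≡0 (suc n)) (sym (toℕ-ι-< z<s))))

    ⊕-comm : ∀ x y → x ⊕ y ≡ y ⊕ x
    ⊕-comm x y = cong ι (+-comm (toℕ x) (toℕ y))

    ⊕-assoc : ∀ x y z → (x ⊕ y) ⊕ z ≡ x ⊕ (y ⊕ z)
    ⊕-assoc x y z = begin
      (x ⊕ y) ⊕ z                      ≡⟨ cong ((x ⊕ y) ⊕_) (ι-toℕ z) ⟨
      (x ⊕ y) ⊕ ι (toℕ z)              ≡⟨ ι-+ (toℕ x + toℕ y) (toℕ z) ⟨
      ι (toℕ x + toℕ y + toℕ z)        ≡⟨ cong ι (+-assoc (toℕ x) _ _) ⟩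
      ι (toℕ x + (toℕ y + toℕ z))      ≡⟨ ι-+ (toℕ x) (toℕ y + toℕ z) ⟩
      ι (toℕ x) ⊕ (y ⊕ z)              ≡⟨ cong (_⊕ (y ⊕ z)) (ι-toℕ x) ⟩
      x ⊕ (y ⊕ z)                      ∎

    ⊕-identityˡ : ∀ x → ι 0 ⊕ x ≡ x
    ⊕-identityˡ x = begin
      ι 0 ⊕ x             ≡⟨ cong (ι 0 ⊕_) (ι-toℕ x) ⟨
      ι 0 ⊕ ι (toℕ x)     ≡⟨ ι-+ 0 (toℕ x) ⟨
      ι (toℕ x)           ≡⟨ ι-toℕ x ⟩
      x                   ∎

    ⊖-inverseˡ : ∀ x → (⊖ x) ⊕ x ≡ ι 0
    ⊖-inverseˡ x = begin
      (⊖ x) ⊕ x                      ≡⟨ cong ((⊖ x) ⊕_) (ι-toℕ x) ⟨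
      (⊖ x) ⊕ ι (toℕ x)              ≡⟨ ι-+ (suc n ∸ toℕ x) (toℕ x) ⟨
      ι (suc n ∸ toℕ x + toℕ x)      ≡⟨ cong ι (m∸n+n≡m (<⇒≤ (toℕ<n x))) ⟩
      ι (suc n)                      ≡⟨ ι-N ⟩
      ι 0                            ∎

  infixl 6 _⊝_
  _⊝_ : Fin (suc n) → Fin (suc n) → Fin (suc n)
  x ⊝ y = x ⊕ (⊖ y)

  abelianGroup : AbelianGroup 0ℓ 0ℓ
  abelianGroup = record
    { _≈_ = _≡_ ; _∙_ = _⊕_ ; ε = ι 0 ; _⁻¹ = ⊖_
    ; isAbelianGroup = record
      { isGroup = record
        { isMonoid = record
          { isSemigroup = record
            { isMagma = record { isEquivalence = isEquivalence ; ∙-cong = cong₂ _⊕_ }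
            ; assoc = ⊕-assoc }
          ; identity = ⊕-identityˡ , λ x → trans (⊕-comm x (ι 0)) (⊕-identityˡ x) }
        ; inverse = ⊖-inverseˡ , λ x → trans (⊕-comm x (⊖ x)) (⊖-inverseˡ x)
        ; ⁻¹-cong = cong ⊖_ }
      ; comm = ⊕-comm } }

  open AbelianGroup abelianGroup public
    using (commutativeSemigroup; identityʳ; inverseˡ; inverseʳ)
  open AbelianGroupProperties abelianGroup public
    using (∙-cancelˡ; inverseʳ-unique; ε⁻¹≈ε; ⁻¹-injective; ⁻¹-anti-homo-//; \\-leftDividesˡ; //-rightDividesˡ; //-rightDividesʳ)

  ⊝-0 : ∀ x → x ⊝ ι 0 ≡ x
  ⊝-0 x = trans (cong (x ⊕_) ε⁻¹≈ε) (identityʳ x)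

-- Edges of sequences; alternating and zigzag sequences.

private variable
  A A′ : Set
  m n k : ℕ

SamePair : A → A → A → A → Set
SamePair x y u v = (x ≡ u × y ≡ v) ⊎ (x ≡ v × y ≡ u)

Edge : ∀ {m} → (Fin m → A) → A → A → Set
Edge f u v = ∃₂ λ i j → toℕ j ≡ suc (toℕ i) × SamePair (f i) (f j) u v

Edge-sym : ∀ {m} {f : Fin m → A} {u v} → Edge f u v → Edge f v u
Edge-sym (i , j , i⋖j , e) = i , j , i⋖j , Sum.swap e

Edge-cong : ∀ {m} (f : A → A′) {p : Fin m → A} {u v} → Edge p u v → Edge (f ∘ p) (f u) (f v)
Edge-cong f (i , j , i⋖j , inj₁ (p , q)) = i , j , i⋖j , inj₁ (cong f p , cong f q)
Edge-cong f (i , j , i⋖j , inj₂ (p , q)) = i , j , i⋖j , inj₂ (cong f p , cong f q)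

Edge-≗ : ∀ {m} {f g : Fin m → A} → (∀ i → f i ≡ g i) → ∀ {u v} → Edge f u v → Edge g u v
Edge-≗ f≗g (i , j , i⋖j , e) = i , j , i⋖j ,
  Sum.map (Product.map (trans (sym (f≗g i))) (trans (sym (f≗g j))))
          (Product.map (trans (sym (f≗g i))) (trans (sym (f≗g j)))) e

Edge-irrefl : ∀ {m} {f : Fin m → A} → Injective _≡_ _≡_ f → ∀ {u v} → Edge f u v → u ≢ v
Edge-irrefl {f = f} f-inj (i , j , i⋖j , e) u≡v =
  1+n≢n (sym (trans (cong toℕ (f-inj (same e))) i⋖j))
  where
  same : SamePair (f i) (f j) _ _ → f i ≡ f j
  same (inj₁ (p , q)) = trans p (trans u≡v (sym q))
  same (inj₂ (p , q)) = trans p (trans (sym u≡v) (sym q))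

Edge-image : ∀ {m} {f : Fin m → A} {u v} → Edge f u v → (∃ λ i → f i ≡ u) × (∃ λ j → f j ≡ v)
Edge-image (i , j , _ , inj₁ (p , q)) = (i , p) , (j , q)
Edge-image (i , j , _ , inj₂ (p , q)) = (j , q) , (i , p)

alt : ℕ → A → A → A
alt zero    x y = x
alt (suc p) x y = alt p y x

alt-pair : ∀ p {x y u v : A} → alt p x y ≡ u → alt p y x ≡ v → SamePair x y u v
alt-pair zero    e e′ = inj₁ (e , e′)
alt-pair (suc p) e e′ = Sum.swap (Sum.map Product.swap Product.swap (alt-pair p e e′))

alt-SamePair : ∀ p {x y : A} → SamePair (alt p x y) (alt p y x) x y
alt-SamePair zero    = inj₁ (refl , refl)
alt-SamePair (suc p) = Sum.swap (alt-SamePair p)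

-- On pairs, `alt p` acts as the identity or the swap, hence as an involution. This recovers x and y
-- from the two second coordinates seen at one edge of a transversal path.
alt-alt : ∀ p {x y : A} → alt p (alt p x y) (alt p y x) ≡ x
alt-alt zero    = refl
alt-alt (suc p) = alt-alt p

alt-const : ∀ p (x : A) → alt p x x ≡ x
alt-const zero    x = refl
alt-const (suc p) x = alt-const p x

-- The sequence f 0, g 0, f 1, g 1, …
zig : (f g : ℕ → A) → ℕ → A
zig f g zero    = f zero
zig f g (suc p) = zig g (f ∘ suc) p

-- The roundings are chosen so that positions p and p + 1 involve the same two terms, `f ⌈ p /2⌉`
-- and `g ⌊ p /2⌋`, in an order given by the parity of p. The p-th edge of a zigzag thus has a
-- description free of case distinctions.
zig-alt : ∀ (f g : ℕ → A) p → zig f g p ≡ alt p (f ⌈ p /2⌉) (g ⌊ p /2⌋)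
zig-alt f g zero    = refl
zig-alt f g (suc p) = zig-alt g (f ∘ suc) p

zig-suc-alt : ∀ (f g : ℕ → A) p → zig f g (suc p) ≡ alt p (g ⌊ p /2⌋) (f ⌈ p /2⌉)
zig-suc-alt f g zero    = refl
zig-suc-alt f g (suc p) = zig-suc-alt g (f ∘ suc) p

Edge-zig : ∀ {s} {f g : ℕ → A} {u v} → Edge {m = suc s} (zig f g ∘ toℕ) u v →
  ∃ λ p → p < s × SamePair (f ⌈ p /2⌉) (g ⌊ p /2⌋) u v
Edge-zig {s = s} {f} {g} (i , j , i⋖j , e) = toℕ i , i<s , same e
  where
  i<s : toℕ i < s
  i<s = ≤-pred (subst (_< suc s) i⋖j (toℕ<n j))
  same : ∀ {u v} → SamePair (zig f g (toℕ i)) (zig f g (toℕ j)) u v →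
         SamePair (f ⌈ toℕ i /2⌉) (g ⌊ toℕ i /2⌋) u v
  same {u} {v} e rewrite i⋖j | zig-alt f g (toℕ i) | zig-suc-alt f g (toℕ i) with e
  ... | inj₁ (a , b) = alt-pair (toℕ i) a b
  ... | inj₂ (a , b) = Sum.swap (alt-pair (toℕ i) a b)

zig-Edge : ∀ {s} (f g : ℕ → A) {p} → p < s → Edge {m = suc s} (zig f g ∘ toℕ) (f ⌈ p /2⌉) (g ⌊ p /2⌋)
zig-Edge {s = s} f g {p} p<s = i , j , trans j≡ (cong suc (sym i≡)) , same
  where
  i j : Fin (suc s)
  i = fromℕ< (m<n⇒m<1+n p<s)
  j = fromℕ< (s<s p<s)
  i≡ : toℕ i ≡ p
  i≡ = toℕ-fromℕ< (m<n⇒m<1+n p<s)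
  j≡ : toℕ j ≡ suc p
  j≡ = toℕ-fromℕ< (s<s p<s)
  same : SamePair (zig f g (toℕ i)) (zig f g (toℕ j)) (f ⌈ p /2⌉) (g ⌊ p /2⌋)
  same = subst₂ (λ a b → SamePair a b _ _)
    (sym (trans (cong (zig f g) i≡) (zig-alt f g p)))
    (sym (trans (cong (zig f g) j≡) (zig-suc-alt f g p)))
    (alt-SamePair p)

zig-even : ∀ (f g : ℕ → A) i → zig f g (i * 2) ≡ f i
zig-even f g zero    = refl
zig-even f g (suc i) = zig-even (f ∘ suc) (g ∘ suc) i

-- With the factor 2 on the right, `suc i * 2` reduces to two successors, as the recursion of `zig`
-- requires.
data Parity : ℕ → Set where
  even : ∀ i → Parity (i * 2)
  odd  : ∀ i → Parity (suc (i * 2))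

parity : ∀ p → Parity p
parity zero    = even 0
parity (suc p) with parity p
... | even i = odd i
... | odd i  = even (suc i)

zig-injective : ∀ h {f g : ℕ → A} →
  (∀ {i j} → i < h → j < h → f i ≡ f j → i ≡ j) →
  (∀ {i j} → i < h → j < h → g i ≡ g j → i ≡ j) →
  (∀ {i j} → i < h → j < h → f i ≢ g j) →
  Injective {A = Fin (h * 2)} _≡_ _≡_ (zig f g ∘ toℕ)
zig-injective h {f} {g} f-inj g-inj f≢g {x} {y} eq =
  toℕ-injective (inj (parity _) (parity _) (toℕ<n x) (toℕ<n y) eq)
  where
  halve : ∀ {i} → i * 2 < h * 2 → i < h
  halve = *-cancelʳ-< _ _ _
  halve′ : ∀ {i} → suc (i * 2) < h * 2 → i < h
  halve′ lt = halve (<-trans (n<1+n _) lt)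
  inj : ∀ {p q} → Parity p → Parity q → p < h * 2 → q < h * 2 → zig f g p ≡ zig f g q → p ≡ q
  inj (even i) (even j) p< q< eq rewrite zig-even f g i | zig-even f g j =
    cong (_* 2) (f-inj (halve p<) (halve q<) eq)
  inj (even i) (odd j) p< q< eq rewrite zig-even f g i | zig-even g (f ∘ suc) j =
    contradiction eq (f≢g (halve p<) (halve′ q<))
  inj (odd i) (even j) p< q< eq rewrite zig-even g (f ∘ suc) i | zig-even f g j =
    contradiction (sym eq) (f≢g (halve q<) (halve′ p<))
  inj (odd i) (odd j) p< q< eq rewrite zig-even g (f ∘ suc) i | zig-even g (f ∘ suc) j =
    cong (λ i → suc (i * 2)) (g-inj (halve′ p<) (halve′ q<) eq)

-- Hamiltonian path decompositions of complete graphs of even order.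

-- Walecki's decomposition of K_{2h} on ℤ/2h, where h = suc t, into the rotations
-- r, r + 1, r − 1, r + 2, … for r < h.  Consecutive vertices of the path r sum to
-- 2r or 2r + 1, so an edge uv lies on the path ⌊(u + v mod 2h) / 2⌋.
module HamiltonianPaths (t : ℕ) where
  open Cyclic (suc (t * 2))
  open CommutativeSemigroupProperties commutativeSemigroup using (interchange)
  open ≡-Reasoning

  N : ℕ
  N = suc (suc (t * 2))

  down up : ℕ → ℕ → Fin N
  down r i = ι r ⊝ ι i
  up   r i = ι r ⊕ ι (suc i)

  ham : ℕ → Fin N → Fin N
  ham r p = zig (down r) (up r) (toℕ p)

  t*2≡t+t : t * 2 ≡ t + t
  t*2≡t+t = trans (*-comm t 2) (cong (t +_) (+-identityʳ t))

  double≤ : ∀ {i j} → i < suc t → j < suc t → i + j ≤ t * 2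
  double≤ {i} {j} i<h j<h = subst (i + j ≤_) (sym t*2≡t+t) (+-mono-≤ (≤-pred i<h) (≤-pred j<h))

  half< : ∀ {i} → i < suc t → suc i < N
  half< i<h = s<s (≤-trans i<h (s≤s (m≤m*n t 2)))

  down-injective : ∀ r {i j} → i < suc t → j < suc t → down r i ≡ down r j → i ≡ j
  down-injective r i< j< eq = ι-injective (<-trans (n<1+n _) (half< i<)) (<-trans (n<1+n _) (half< j<))
    (⁻¹-injective (∙-cancelˡ _ _ _ eq))

  up-injective : ∀ r {i j} → i < suc t → j < suc t → up r i ≡ up r j → i ≡ j
  up-injective r i< j< eq = suc-injective (ι-injective (half< i<) (half< j<) (∙-cancelˡ _ _ _ eq))

  -- Equality would make j + 1 + i vanish modulo N, but this number lies strictly between 0 and N.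
  down≢up : ∀ r {i j} → i < suc t → j < suc t → down r i ≢ up r j
  down≢up r {i} {j} i< j< eq = 1+n≢0 (ι-injective (s<s (s≤s (double≤ j< i<))) z<s (begin
    ι (suc j + i)          ≡⟨ ι-+ (suc j) i ⟩
    ι (suc j) ⊕ ι i        ≡⟨ cong (_⊕ ι i) (∙-cancelˡ _ _ _ eq) ⟨
    (⊖ ι i) ⊕ ι i          ≡⟨ inverseˡ (ι i) ⟩
    ι 0                    ∎))

  ham-injective : ∀ r → Injective _≡_ _≡_ (ham r)
  ham-injective r = zig-injective (suc t) (down-injective r) (up-injective r) (down≢up r)

  -- With `toℕ-ham-1`: the path starts with the integers r and r + 1, without wrapping around, hence
  -- with opposite parities. The 2-colouring below rests on this.
  toℕ-ham-0 : ∀ {r} → r < suc t → toℕ (ham r zero) ≡ r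
  toℕ-ham-0 {r} r<h = trans (cong toℕ (⊝-0 (ι r))) (toℕ-ι-< (<-trans (n<1+n r) (half< r<h)))

  toℕ-ham-1 : ∀ {r} → r < suc t → toℕ (ham r (suc zero)) ≡ suc r
  toℕ-ham-1 {r} r<h = trans (cong toℕ (trans (sym (ι-+ r 1)) (cong ι (+-comm r 1)))) (toℕ-ι-< (half< r<h))

  sum : ∀ r i j → down r i ⊕ up r j ≡ ι (r + r) ⊕ (ι (suc j) ⊝ ι i)
  sum r i j = begin
    (ι r ⊝ ι i) ⊕ (ι r ⊕ ι (suc j))      ≡⟨ interchange _ _ _ _ ⟩
    (ι r ⊕ ι r) ⊕ ((⊖ ι i) ⊕ ι (suc j))  ≡⟨ cong₂ _⊕_ (sym (ι-+ r r)) (⊕-comm _ _) ⟩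
    ι (r + r) ⊕ (ι (suc j) ⊝ ι i)        ∎

  sum-odd : ∀ r i → down r i ⊕ up r i ≡ ι (suc (r + r))
  sum-odd r i = begin
    down r i ⊕ up r i                 ≡⟨ sum r i i ⟩
    ι (r + r) ⊕ (ι (suc i) ⊝ ι i)     ≡⟨ cong (λ x → ι (r + r) ⊕ (x ⊝ ι i)) (ι-+ 1 i) ⟩
    ι (r + r) ⊕ ((ι 1 ⊕ ι i) ⊝ ι i)   ≡⟨ cong (ι (r + r) ⊕_) (//-rightDividesʳ (ι i) (ι 1)) ⟩
    ι (r + r) ⊕ ι 1                   ≡⟨ ι-+ (r + r) 1 ⟨
    ι (r + r + 1)                     ≡⟨ cong ι (+-comm (r + r) 1) ⟩
    ι (suc (r + r))                   ∎

  sum-even : ∀ r i → down r (suc i) ⊕ up r i ≡ ι (r + r)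
  sum-even r i = begin
    down r (suc i) ⊕ up r i              ≡⟨ sum r (suc i) i ⟩
    ι (r + r) ⊕ (ι (suc i) ⊝ ι (suc i))  ≡⟨ cong (ι (r + r) ⊕_) (inverseʳ (ι (suc i))) ⟩
    ι (r + r) ⊕ ι 0                      ≡⟨ identityʳ _ ⟩
    ι (r + r)                            ∎

  ceil : ∀ p → ⌈ p /2⌉ ≡ ⌊ p /2⌋ ⊎ ⌈ p /2⌉ ≡ suc ⌊ p /2⌋
  ceil zero          = inj₁ refl
  ceil (suc zero)    = inj₂ refl
  ceil (suc (suc p)) = Sum.map (cong suc) (cong suc) (ceil p)

  index : Fin N → Fin N → ℕ
  index u v = ⌊ toℕ (u ⊕ v) /2⌋

  double< : ∀ {r} → r < suc t → suc (r + r) < N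
  double< r< = s<s (s≤s (double≤ r< r<))

  -- Since r < h, both 2r and 2r + 1 are below N, so no reduction modulo N disturbs the halving.
  index-down-up : ∀ {r} p → r < suc t → index (down r ⌈ p /2⌉) (up r ⌊ p /2⌋) ≡ r
  index-down-up {r} p r<h with ceil p
  ... | inj₁ eq rewrite eq | sum-odd r ⌊ p /2⌋ | toℕ-ι-< (double< r<h) = sym (n≡⌈n+n/2⌉ r)
  ... | inj₂ eq rewrite eq | sum-even r ⌊ p /2⌋ | toℕ-ι-< (<-trans (n<1+n _) (double< r<h)) = sym (n≡⌊n+n/2⌋ r)

  ham-sound : ∀ {r u v} → r < suc t → Edge (ham r) u v → r ≡ index u v
  ham-sound {r} {u} {v} r<h e with Edge-zig e
  ... | p , _ , inj₁ (refl , refl) = sym (index-down-up p r<h)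
  ... | p , _ , inj₂ (refl , refl) = trans (sym (index-down-up p r<h)) (cong (λ x → ⌊ toℕ x /2⌋) (⊕-comm _ _))

  negate : ∀ {d d′} → d + d′ ≡ N → ι d′ ≡ ⊖ ι d
  negate {d} {d′} eq = inverseʳ-unique (ι d) (ι d′) (trans (sym (ι-+ d d′)) (trans (cong ι eq) ι-N))

  reflect : ∀ x u → x ⊝ ι (toℕ (x ⊝ u)) ≡ u
  reflect x u = begin
    x ⊝ ι (toℕ (x ⊝ u))   ≡⟨ cong (x ⊝_) (ι-toℕ (x ⊝ u)) ⟩
    x ⊝ (x ⊝ u)           ≡⟨ cong (x ⊕_) (⁻¹-anti-homo-// x u) ⟩
    x ⊕ (u ⊝ x)           ≡⟨ ⊕-comm _ _ ⟩
    (u ⊝ x) ⊕ x           ≡⟨ //-rightDividesˡ x u ⟩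
    u                     ∎

  -- The path r is Hamiltonian: let d be the residue r - u. If d < h, then u = r - d; otherwise u =
  -- r + (N - d) with N - d ≤ h, and `d′` is N - d - 1 because `up` is shifted by one.
  occurs : ∀ r u → (∃ λ i → i < suc t × u ≡ down r i) ⊎ (∃ λ i → i < suc t × u ≡ up r i)
  occurs r u with toℕ (ι r ⊝ u) <? suc t
  ... | yes d<h = inj₁ (toℕ (ι r ⊝ u) , d<h , sym (reflect (ι r) u))
  ... | no d≮h = inj₂ (d′ , s≤s d′≤t , u≡)
    where
    d d′ : ℕ
    d = toℕ (ι r ⊝ u)
    d′ = suc (t * 2) ∸ d
    sum≡ : d + suc d′ ≡ N
    sum≡ = trans (+-suc d d′) (cong suc (m+[n∸m]≡n (≤-pred (toℕ<n (ι r ⊝ u)))))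
    d′≤t : d′ ≤ t
    d′≤t = subst (d′ ≤_) (trans (cong (_∸ t) t*2≡t+t) (m+n∸n≡m t t)) (∸-monoʳ-≤ (suc (t * 2)) (≮⇒≥ d≮h))
    u≡ : u ≡ up r d′
    u≡ = sym (trans (cong (ι r ⊕_) (negate sum≡)) (reflect (ι r) u))

  odd-edge : ∀ r {i} → i < suc t → Edge (ham r) (down r i) (up r i)
  odd-edge r {i} i<h = subst₂ (λ a b → Edge (ham r) (down r a) (up r b))
    (sym (n≡⌈n+n/2⌉ i)) (sym (n≡⌊n+n/2⌋ i))
    (zig-Edge (down r) (up r) {i + i} (s≤s (double≤ i<h i<h)))

  -- This is edge number 2i + 1. For i = t there is none: `up r t` is the last vertex of the path.
  even-edge : ∀ r {i} → i < t → Edge (ham r) (down r (suc i)) (up r i)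
  even-edge r {i} i<t = subst₂ (λ a b → Edge (ham r) (down r a) (up r b))
    (cong suc (sym (n≡⌊n+n/2⌋ i))) (sym (n≡⌈n+n/2⌉ i))
    (zig-Edge (down r) (up r) {suc (i + i)} (s<s (subst (i + i <_) (sym t*2≡t+t) (+-mono-< i<t i<t))))

  -- Find u on the path r. Its neighbour on the side given by the parity of u + v has the same sum
  -- with u as v has, so it is v by cancellation. Only an end of the path can lack this neighbour,
  -- and there the sum 2r forces u = v.
  ham-complete : ∀ {u v} → u ≢ v → Edge (ham (index u v)) u v
  ham-complete {u} {v} u≢v = by-parity (ceil σ) (occurs r u)
    where
    σ r : ℕ
    σ = toℕ (u ⊕ v)
    r = index u v
    σ-even : ⌈ σ /2⌉ ≡ r → u ⊕ v ≡ ι (r + r)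
    σ-even eq = trans (sym (ι-toℕ (u ⊕ v))) (cong ι (trans (sym (⌊n/2⌋+⌈n/2⌉≡n σ)) (cong (r +_) eq)))
    σ-odd : ⌈ σ /2⌉ ≡ suc r → u ⊕ v ≡ ι (suc (r + r))
    σ-odd eq = trans (sym (ι-toℕ (u ⊕ v)))
      (cong ι (trans (sym (⌊n/2⌋+⌈n/2⌉≡n σ)) (trans (cong (r +_) eq) (+-suc r r))))
    partner : ∀ {x y z w} → z ≡ x → z ⊕ w ≡ x ⊕ y → w ≡ y
    partner refl eq = ∙-cancelˡ _ _ _ eq
    partner′ : ∀ {x y z w} → z ≡ y → z ⊕ w ≡ x ⊕ y → w ≡ x
    partner′ refl eq = ∙-cancelˡ _ _ _ (trans eq (⊕-comm _ _))
    by-parity : ⌈ σ /2⌉ ≡ r ⊎ ⌈ σ /2⌉ ≡ suc r →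
                (∃ λ i → i < suc t × u ≡ down r i) ⊎ (∃ λ i → i < suc t × u ≡ up r i) →
                Edge (ham r) u v
    by-parity (inj₂ o) (inj₁ (i , i<h , u≡)) =
      subst₂ (Edge (ham r)) (sym u≡) (sym (partner u≡ (trans (σ-odd o) (sym (sum-odd r i))))) (odd-edge r i<h)
    by-parity (inj₂ o) (inj₂ (i , i<h , u≡)) =
      Edge-sym (subst₂ (Edge (ham r)) (sym (partner′ u≡ (trans (σ-odd o) (sym (sum-odd r i))))) (sym u≡) (odd-edge r i<h))
    -- First vertex: u = r, and u + v = 2r gives v = r.
    by-parity (inj₁ e) (inj₁ (zero , _ , u≡)) = contradiction u≡v u≢v
      where
      u≡ιr : u ≡ ι r
      u≡ιr = trans u≡ (⊝-0 (ι r))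
      u≡v : u ≡ v
      u≡v = trans u≡ιr (sym (partner u≡ιr (trans (σ-even e) (ι-+ r r))))
    by-parity (inj₁ e) (inj₁ (suc i , i<h , u≡)) =
      subst₂ (Edge (ham r)) (sym u≡) (sym (partner u≡ (trans (σ-even e) (sym (sum-even r i))))) (even-edge r (≤-pred i<h))
    by-parity (inj₁ e) (inj₂ (i , i<h , u≡)) with m≤n⇒m<n∨m≡n (≤-pred i<h)
    ... | inj₁ i<t =
      Edge-sym (subst₂ (Edge (ham r)) (sym (partner′ u≡ (trans (σ-even e) (sym (sum-even r i))))) (sym u≡) (even-edge r i<t))
    ... | inj₂ i≡t = contradiction u≡v u≢v
      where
      -- Last vertex: u = r + h, and u + v = 2r gives v = r - h, which equals u because 2h = N.
      antipode : ∀ {i} → i ≡ t → ι (suc i) ≡ ⊖ ι (suc i)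
      antipode refl = negate (trans (cong suc (+-suc t t)) (cong (λ n → suc (suc n)) (sym t*2≡t+t)))
      u≡v : u ≡ v
      u≡v = trans u≡ (trans (cong (ι r ⊕_) (antipode i≡t)) (sym (partner′ u≡ (trans (σ-even e) (sym (sum-even r i))))))

  index< : ∀ u v → index u v < suc t
  index< u v = s≤s (subst (index u v ≤_) (sym (n≡⌈n+n/2⌉ t))
    (subst (λ n → index u v ≤ ⌊ suc n /2⌋) t*2≡t+t (⌊n/2⌋-mono (≤-pred (toℕ<n (u ⊕ v))))))

-- Path decompositions of complete bipartite graphs.

-- Decomposition of K_{s,s}, s = 2h − 1, into the rotations of a zigzag whose p-th
-- edge joins vertices a, b of the two sides with b − a = p in ℤ/s.
module BipartitePaths (t : ℕ) where
  open Cyclic (t * 2)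
  open ≡-Reasoning

  s : ℕ
  s = suc (t * 2)

  module _ {W : Set} (w w′ : W) where
    left right : Fin s → ℕ → W × Fin s
    left  x i = w  , x ⊝ ι i
    right x i = w′ , x ⊕ ι i

    bip : Fin s → Fin (suc s) → W × Fin s
    bip x p = zig (left x) (right x) (toℕ p)

    small : ∀ {i} → i < suc t → i < s
    small i<h = ≤-trans i<h (s≤s (m≤m*n t 2))

    bip-injective : w ≢ w′ → ∀ x → Injective _≡_ _≡_ (bip x)
    bip-injective w≢w′ x = zig-injective (suc t)
      (λ i< j< eq → ι-injective (small i<) (small j<) (⁻¹-injective (∙-cancelˡ _ _ _ (cong proj₂ eq))))
      (λ i< j< eq → ι-injective (small i<) (small j<) (∙-cancelˡ _ _ _ (cong proj₂ eq)))
      (λ _ _ eq → w≢w′ (cong proj₁ eq))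

    -- The rotation containing the edge from a to b: its edge number is p = b - a, and on the
    -- rotation x the left end of that edge is x - ⌈p/2⌉.
    start : Fin s → Fin s → Fin s
    start a b = a ⊕ ι ⌈ toℕ (b ⊝ a) /2⌉

    difference : ∀ x p → (x ⊕ ι ⌊ p /2⌋) ⊝ (x ⊝ ι ⌈ p /2⌉) ≡ ι p
    difference x p = begin
      (x ⊕ ι ⌊ p /2⌋) ⊝ (x ⊝ ι ⌈ p /2⌉)      ≡⟨ cong ((x ⊕ ι ⌊ p /2⌋) ⊕_) (⁻¹-anti-homo-// _ _) ⟩
      (x ⊕ ι ⌊ p /2⌋) ⊕ (ι ⌈ p /2⌉ ⊝ x)      ≡⟨ cong₂ _⊕_ (⊕-comm _ _) (⊕-comm _ _) ⟩
      (ι ⌊ p /2⌋ ⊕ x) ⊕ ((⊖ x) ⊕ ι ⌈ p /2⌉)  ≡⟨ ⊕-assoc _ _ _ ⟩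
      ι ⌊ p /2⌋ ⊕ (x ⊕ ((⊖ x) ⊕ ι ⌈ p /2⌉))  ≡⟨ cong (ι ⌊ p /2⌋ ⊕_) (\\-leftDividesˡ x _) ⟩
      ι ⌊ p /2⌋ ⊕ ι ⌈ p /2⌉                  ≡⟨ ι-+ _ _ ⟨
      ι (⌊ p /2⌋ + ⌈ p /2⌉)                  ≡⟨ cong ι (⌊n/2⌋+⌈n/2⌉≡n p) ⟩
      ι p                                    ∎

    start-edge : ∀ x {p} → p < s → start (x ⊝ ι ⌈ p /2⌉) (x ⊕ ι ⌊ p /2⌋) ≡ x
    start-edge x {p} p<s = begin
      (x ⊝ c) ⊕ ι ⌈ toℕ ((x ⊕ ι ⌊ p /2⌋) ⊝ (x ⊝ c)) /2⌉ ≡⟨ cong (λ n → (x ⊝ c) ⊕ ι ⌈ n /2⌉) length ⟩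
      (x ⊝ c) ⊕ c                                       ≡⟨ //-rightDividesˡ c x ⟩
      x                                                 ∎
      where
      c : Fin s
      c = ι ⌈ p /2⌉
      length : toℕ ((x ⊕ ι ⌊ p /2⌋) ⊝ (x ⊝ c)) ≡ p
      length = trans (cong toℕ (difference x p)) (toℕ-ι-< p<s)

    bip-sound : ∀ {x u v} → Edge (bip x) u v → ∃₂ λ a b → SamePair (w , a) (w′ , b) u v × x ≡ start a b
    bip-sound {x} e with Edge-zig e
    ... | p , p<s , same = _ , _ , same , sym (start-edge x p<s)

    bip-complete : ∀ a b → Edge (bip (start a b)) (w , a) (w′ , b)
    bip-complete a b = subst₂ (λ a b → Edge (bip x) (w , a) (w′ , b))
      (//-rightDividesʳ c a) right≡ (zig-Edge (left x) (right x) (toℕ<n (b ⊝ a)))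
      where
      p : ℕ
      p = toℕ (b ⊝ a)
      c x : Fin s
      c = ι ⌈ p /2⌉
      x = start a b
      right≡ : x ⊕ ι ⌊ p /2⌋ ≡ b
      right≡ = begin
        (a ⊕ c) ⊕ ι ⌊ p /2⌋             ≡⟨ ⊕-assoc _ _ _ ⟩
        a ⊕ (c ⊕ ι ⌊ p /2⌋)             ≡⟨ cong (a ⊕_) (trans (⊕-comm _ _) (sym (ι-+ ⌊ p /2⌋ ⌈ p /2⌉))) ⟩
        a ⊕ ι (⌊ p /2⌋ + ⌈ p /2⌉)       ≡⟨ cong (λ n → a ⊕ ι n) (⌊n/2⌋+⌈n/2⌉≡n p) ⟩
        a ⊕ ι p                         ≡⟨ cong (a ⊕_) (ι-toℕ (b ⊝ a)) ⟩
        a ⊕ (b ⊝ a)                     ≡⟨ ⊕-comm _ _ ⟩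
        (b ⊝ a) ⊕ a                     ≡⟨ //-rightDividesˡ a b ⟩
        b                               ∎

-- Finite types and codes for functions.

Finite : Set → Set
Finite A = ∃ λ n → A ↔ Fin n

Fin-finite : Finite (Fin n)
Fin-finite = _ , ↔-refl

_×-finite_ : Finite A → Finite A′ → Finite (A × A′)
(_ , f) ×-finite (_ , g) = _ , ↔-trans (f ×-↔ g) (↔-sym *↔×)

_⊎-finite_ : Finite A → Finite A′ → Finite (A ⊎ A′)
(_ , f) ⊎-finite (_ , g) = _ , ↔-trans (f ⊎-↔ g) (↔-sym +↔⊎)

Maybe-finite : Finite A → Finite (Maybe A)
Maybe-finite (n , f) = suc n , mk↔ₛ′
  (λ { nothing → zero ; (just x) → suc (Inverse.to f x) })
  (λ { zero → nothing ; (suc i) → just (Inverse.from f i) })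
  (λ { zero → refl ; (suc i) → cong suc (Inverse.strictlyInverseˡ f i) })
  (λ { nothing → refl ; (just x) → cong just (Inverse.strictlyInverseʳ f x) })

Finite-any? : ∀ {P : A → Set} → Finite A → (∀ x → Dec (P x)) → Dec (∃ P)
Finite-any? {P = P} (_ , f) P? = map′
  (λ (i , p) → Inverse.from f i , p)
  (λ (x , p) → Inverse.to f x , subst P (sym (Inverse.strictlyInverseʳ f x)) p)
  (any? (λ i → P? (Inverse.from f i)))

-- Codes for the functions B → V up to pointwise equality.
module Exponential {V B : Set} (V-finite : Finite V) (B-finite : Finite B) where
  open Inverse (proj₂ V-finite) using () renaming (to to toV; from to fromV; strictlyInverseʳ to fromV∘toV)
  open Inverse (proj₂ B-finite) using () renaming (to to toB; from to fromB; strictlyInverseʳ to fromB∘toB)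

  Code : Set
  Code = Fin (proj₁ V-finite ^ proj₁ B-finite)

  decode : Code → B → V
  decode c = fromV ∘ finToFun c ∘ toB

  decode-surjective : ∀ f → ∃ λ c → ∀ b → decode c b ≡ f b
  decode-surjective f = funToFin (toV ∘ f ∘ fromB) , λ b → trans
    (cong fromV (finToFun-funToFin (toV ∘ f ∘ fromB) (toB b)))
    (trans (fromV∘toV _) (cong f (fromB∘toB b)))

-- Packings of edge-disjoint routes that admit no colouring.

Mono : {V : Set} → (V → Fin k) → (Fin m → V) → Set
Mono colour f = ∃ λ c → ∀ i → colour (f i) ≡ c

HasColouring : {V B : Set} → ℕ → (B → Fin m → V) → Set
HasColouring {V = V} k f = ∃ λ (colour : V → Fin k) → ∀ b → ¬ Mono colour (f b)

record Packing (m : ℕ) (V B : Set) : Set where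
  field
    route    : B → Fin m → V
    simple   : ∀ b → Injective _≡_ _≡_ (route b)
    disjoint : ∀ {b b′ u v} → Edge (route b) u v → Edge (route b′) u v → b ≡ b′

open Packing

-- Routes on an index set I whose vertices carry labels in V, such that every
-- choice t of one element of V per index agrees with the labels along some route.
record Unavoidable (m : ℕ) (V : Set) : Set₁ where
  field
    {I B}    : Set
    I-finite : Finite I
    B-finite : Finite B
    packing  : Packing m I B
    label    : B → Fin m → V
    agrees   : ∀ (t : I → V) → ∃ λ b → ∀ p → t (route packing b p) ≡ label b p

-- To lengthen the routes by one vertex, take a new index for each route b and a
-- copy of the old indices for each function c from routes to V; in copy c, attach
-- the new index of b, labelled c b, to the start of b.  A choice t determines c by
-- its values at the new indices, and then b by its values on the copy c.
unavoidable : {V : Set} → Finite V → ∀ m → Unavoidable m V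
unavoidable V-finite zero = record
  { I = Fin 0
  -- One empty route, with which every choice agrees vacuously.
  ; B = Fin 1
  ; I-finite = Fin-finite
  ; B-finite = Fin-finite
  ; packing  = record { route = λ _ () ; simple = λ { _ {()} } ; disjoint = λ { (() , _) } }
  ; label    = λ _ ()
  ; agrees   = λ _ → zero , λ ()
  }
unavoidable {V} V-finite (suc m) = record
  { I-finite = (Fin-finite ×-finite I-finite) ⊎-finite B-finite
  ; B-finite = Fin-finite ×-finite B-finite
  ; packing  = record { route = route′ ; simple = simple′ ; disjoint = λ e e′ → unique (classify e) (classify e′) }
  ; label    = label′
  ; agrees   = agrees′
  }
  where
  open Unavoidable (unavoidable V-finite m)
  open Exponential V-finite B-finite

  I′ B′ : Set
  I′ = (Code × I) ⊎ B
  B′ = Code × B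

  route′ : B′ → Fin (suc m) → I′
  route′ (c , b) zero    = inj₂ b
  route′ (c , b) (suc p) = inj₁ (c , route packing b p)

  label′ : B′ → Fin (suc m) → V
  label′ (c , b) zero    = decode c b
  label′ (c , b) (suc p) = label b p

  simple′ : ∀ b → Injective _≡_ _≡_ (route′ b)
  simple′ (c , b) {zero}  {zero}  eq = refl
  simple′ (c , b) {suc p} {suc q} eq = cong suc (simple packing b (,-injectiveʳ (inj₁-injective eq)))

  -- Every edge of `route′ (c , b)` reveals the copy c, together with either b itself or an edge of
  -- the old route b. Hence it determines the route.
  data Classified : B′ → I′ → I′ → Set where
    new  : ∀ {c b i} → Classified (c , b) (inj₂ b) (inj₁ (c , i))
    new′ : ∀ {c b i} → Classified (c , b) (inj₁ (c , i)) (inj₂ b)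
    old  : ∀ {c b i j} → Edge (route packing b) i j → Classified (c , b) (inj₁ (c , i)) (inj₁ (c , j))

  classify : ∀ {b u v} → Edge (route′ b) u v → Classified b u v
  classify (zero , suc j , _ , inj₁ (refl , refl)) = new
  classify (zero , suc j , _ , inj₂ (refl , refl)) = new′
  classify (suc i , suc j , eq , inj₁ (refl , refl)) = old (i , j , suc-injective eq , inj₁ (refl , refl))
  classify (suc i , suc j , eq , inj₂ (refl , refl)) = old (i , j , suc-injective eq , inj₂ (refl , refl))

  unique : ∀ {b b′ u v} → Classified b u v → Classified b′ u v → b ≡ b′
  unique new new         = refl
  unique new′ new′       = refl
  unique (old e) (old e′) = cong (_ ,_) (disjoint packing e e′)

  agrees′ : ∀ (t : I′ → V) → ∃ λ b → ∀ p → t (route′ b p) ≡ label′ b p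
  agrees′ t with decode-surjective (t ∘ inj₂)
  ... | c , c≗t with agrees (λ i → t (inj₁ (c , i)))
  ... | b , eq = (c , b) , λ { zero → sym (c≗t b) ; (suc p) → eq p }

record Uncolourable (m k : ℕ) : Set₁ where
  field
    {V B}        : Set
    V-finite     : Finite V
    B-finite     : Finite B
    packing      : Packing m V B
    uncolourable : ¬ HasColouring k (route packing)

-- In the induction step, I indexes the copies of V, and `label` tells through which vertex of each
-- copy a cross route passes.
uncolourable-packing : ∀ m k → Uncolourable m k
uncolourable-packing m zero = record
  -- Without colours a single vertex is an obstruction, whereas an empty V would be colourable.
  { V = Fin 1
  ; B = Fin 0
  ; V-finite = Fin-finite
  ; B-finite = Fin-finite
  ; packing = record { route = λ () ; simple = λ () ; disjoint = λ { {()} } }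
  ; uncolourable = λ (colour , _) → contradiction (colour zero) λ ()
  }
uncolourable-packing m (suc k) = record
  { V = I × V
  ; B = (I × B) ⊎ J
  ; V-finite = I-finite ×-finite V-finite
  ; B-finite = (I-finite ×-finite B-finite) ⊎-finite J-finite
  ; packing = record { route = route′ ; simple = simple′ ; disjoint = λ {b} {b′} → disjoint′ b b′ }
  ; uncolourable = uncolourable′
  }
  where
  open Uncolourable (uncolourable-packing m k)
  open Unavoidable (unavoidable V-finite m) using (I; I-finite; label; agrees)
    renaming (B to J; B-finite to J-finite; packing to cross)

  route′ : (I × B) ⊎ J → Fin m → I × V
  route′ (inj₁ (i , b)) p = i , route packing b p
  route′ (inj₂ j)       p = route cross j p , label j p

  simple′ : ∀ b → Injective _≡_ _≡_ (route′ b)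
  simple′ (inj₁ (i , b)) eq = simple packing b (cong proj₂ eq)
  simple′ (inj₂ j)       eq = simple cross j (cong proj₁ eq)

  block : ∀ {i b u v} → Edge (route′ (inj₁ (i , b))) u v → i ≡ proj₁ u × i ≡ proj₁ v
  block e with Edge-image e
  ... | (_ , refl) , (_ , refl) = refl , refl

  -- A block edge stays in one copy, while a cross edge projects to an edge of a simple route in I
  -- and so joins two different copies.
  separate : ∀ {i b j u v} → Edge (route′ (inj₁ (i , b))) u v → ¬ Edge (route′ (inj₂ j)) u v
  separate {j = j} e e′ = Edge-irrefl (simple cross j) (Edge-cong proj₁ e′)
    (trans (sym (proj₁ (block e))) (proj₂ (block e)))

  disjoint′ : ∀ b b′ {u v} → Edge (route′ b) u v → Edge (route′ b′) u v → b ≡ b′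
  disjoint′ (inj₁ (i , b)) (inj₁ (i′ , b′)) e e′ =
    cong inj₁ (cong₂ _,_ (trans (proj₁ (block e)) (sym (proj₁ (block e′))))
                         (disjoint packing (Edge-cong proj₂ e) (Edge-cong proj₂ e′)))
  disjoint′ (inj₁ _) (inj₂ _) e e′ = contradiction e′ (separate e)
  disjoint′ (inj₂ _) (inj₁ _) e e′ = contradiction e (separate e′)
  disjoint′ (inj₂ j) (inj₂ j′) e e′ = cong inj₂ (disjoint cross (Edge-cong proj₁ e) (Edge-cong proj₁ e′))

  uncolourable′ : ¬ HasColouring (suc k) route′
  uncolourable′ (colour , proper) = proper (inj₂ j) (zero , λ p →
    trans (cong (λ v → colour (route cross j p , v)) (sym (eq p))) (proj₂ (zero-coloured (route cross j p))))
    where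
    zero-coloured : ∀ i → ∃ λ v → colour (i , v) ≡ zero
    zero-coloured i with Finite-any? V-finite (λ v → colour (i , v) Fin.≟ zero)
    ... | yes found = found
    -- A block without a vertex of colour zero is properly coloured by the other k colours.
    ... | no ∄ = contradiction ((λ v → punchOut (nonzero v)) , proper-block) uncolourable
      where
      nonzero : ∀ v → zero ≢ colour (i , v)
      nonzero v eq = ∄ (v , sym eq)
      proper-block : ∀ b → ¬ Mono (λ v → punchOut (nonzero v)) (route packing b)
      proper-block b (c , mono) = proper (inj₁ (i , b))
        (suc c , λ p → trans (sym (punchIn-punchOut (nonzero _))) (cong suc (mono p)))
    -- The cross route agreeing with the choice of a vertex of colour zero in each copy; it is
    -- monochromatic.
    j = proj₁ (agrees (proj₁ ∘ zero-coloured))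
    eq = proj₂ (agrees (proj₁ ∘ zero-coloured))

-- Finiteness of decidable subsets.

-- `Refinement` makes the membership proof irrelevant, so each element is counted once, however many
-- proofs of P it has.
filter-Fin : ∀ {n} {P : Fin n → Set} → (∀ i → Dec (P i)) → Finite (Refinement (Fin n) P)
filter-Fin {zero}  P? = 0 , mk↔ₛ′ (λ { (() , _) }) (λ ()) (λ ()) (λ { (() , _) })
filter-Fin {suc n} {P} P? with filter-Fin (P? ∘ suc) | P? zero
... | k , f | yes p₀ = suc k , mk↔ₛ′ to from to∘from from∘to
  where
  to : Refinement (Fin (suc n)) P → Fin (suc k)
  to (zero  , p) = zero
  to (suc i , p) = suc (Inverse.to f (i , p))
  from : Fin (suc k) → Refinement (Fin (suc n)) P
  from zero    = zero , [ p₀ ]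
  from (suc j) = let i , p = Inverse.from f j in suc i , p
  to∘from : ∀ j → to (from j) ≡ j
  to∘from zero    = refl
  to∘from (suc j) = cong suc (Inverse.strictlyInverseˡ f j)
  from∘to : ∀ i → from (to i) ≡ i
  from∘to (zero  , p) = refl
  from∘to (suc i , p) = value-injective (cong (suc ∘ value) (Inverse.strictlyInverseʳ f (i , p)))
... | k , f | no ¬p₀ = k , mk↔ₛ′ to from to∘from from∘to
  where
  to : Refinement (Fin (suc n)) P → Fin k
  to (zero  , [ p ]) = ⊥-elim-irr (¬p₀ p)
  to (suc i , p) = Inverse.to f (i , p)
  from : Fin k → Refinement (Fin (suc n)) P
  from j = let i , p = Inverse.from f j in suc i , p
  to∘from : ∀ j → to (from j) ≡ j
  to∘from j = Inverse.strictlyInverseˡ f j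
  from∘to : ∀ i → from (to i) ≡ i
  from∘to (zero  , [ p ]) = ⊥-elim-irr (¬p₀ p)
  from∘to (suc i , p) = value-injective (cong (suc ∘ value) (Inverse.strictlyInverseʳ f (i , p)))

filter-finite : ∀ {P : A → Set} → Finite A → (∀ x → Dec (P x)) → Finite (Refinement A P)
filter-finite {P = P} (n , f) P? with filter-Fin (P? ∘ Inverse.from f)
... | k , g = k , ↔-trans (mk↔ₛ′
  (λ { (x , [ p ]) → Inverse.to f x , [ subst P (sym (Inverse.strictlyInverseʳ f x)) p ] })
  (λ { (i , p) → Inverse.from f i , p })
  (λ { (i , p) → value-injective (Inverse.strictlyInverseˡ f i) })
  (λ { (x , p) → value-injective (Inverse.strictlyInverseʳ f x) })) g

-- The completion of a packing to a path system.

Edge-just : ∀ {m} {f : Fin m → A} {u v} → Edge (just ∘ f) u v →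
            ∃₂ λ a b → u ≡ just a × v ≡ just b × Edge f a b
Edge-just {f = f} (i , j , i⋖j , inj₁ (refl , refl)) = f i , f j , refl , refl , i , j , i⋖j , inj₁ (refl , refl)
Edge-just {f = f} (i , j , i⋖j , inj₂ (refl , refl)) = f j , f i , refl , refl , i , j , i⋖j , inj₂ (refl , refl)

Edge? : ∀ {n m} (f : Fin m → Fin n) u v → Dec (Edge f u v)
Edge? f u v = any? λ i → any? λ j → (toℕ j ≟ suc (toℕ i)) ×-dec
  (((f i Fin.≟ u) ×-dec (f j Fin.≟ v)) ⊎-dec ((f i Fin.≟ v) ×-dec (f j Fin.≟ u)))

-- Here m = N = 2h with h = suc t; the vertex ∞ is nothing.
module Completion (t : ℕ) where
  open HamiltonianPaths t using (N; ham; ham-injective; index; index<; ham-sound; ham-complete)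
  open BipartitePaths t using (s; bip; bip-injective; start; bip-sound; bip-complete)

  Vertex : ℕ → Set
  Vertex n = Maybe (Fin n × Fin s)

  embed : ∀ {n} → Fin n → Fin N → Vertex n
  embed w zero    = nothing
  embed w (suc a) = just (w , a)

  embed-injective : ∀ {n} {w : Fin n} → Injective _≡_ _≡_ (embed w)
  embed-injective {x = zero}  {zero}  _    = refl
  embed-injective {x = suc _} {suc _} refl = refl

  -- All groups share ∞, so the pair ∞, ∞ would not determine w; `u ≢ v` excludes it, and one end
  -- then names the group.
  Inner : ∀ {n} → Fin n → Fin N → Fin N → Vertex n → Vertex n → Set
  Inner w x y u v = embed w x ≡ u × embed w y ≡ v × u ≢ v

  Inner-unique : ∀ {n} {w w′ : Fin n} {x x′ y y′ u v} → Inner w x y u v → Inner w′ x′ y′ u v →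
                 w ≡ w′ × x ≡ x′ × y ≡ y′
  Inner-unique {x = zero}  {zero}  {zero}  {zero}  (refl , refl , u≢v) _ = contradiction refl u≢v
  Inner-unique {x = zero}  {zero}  {suc _} {suc _} (refl , refl , _) (_ , refl , _) = refl , refl , refl
  Inner-unique {x = suc _} {suc _} {zero}  {zero}  (refl , refl , _) (refl , _ , _) = refl , refl , refl
  Inner-unique {x = suc _} {suc _} {suc _} {suc _} (refl , refl , _) (refl , refl , _) = refl , refl , refl
  Inner-unique {x = zero}  {zero}  {zero}  {suc _} (refl , refl , _) (_ , () , _)
  Inner-unique {x = zero}  {zero}  {suc _} {zero}  (refl , refl , _) (_ , () , _)
  Inner-unique {x = suc _} {suc _} {zero}  {suc _} (refl , refl , _) (_ , () , _)
  Inner-unique {x = suc _} {suc _} {suc _} {zero}  (refl , refl , _) (_ , () , _)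

  ¬Inner-cross : ∀ {n} {w w₁ w₂ : Fin n} {x y a b} → w₁ ≢ w₂ → ¬ Inner w x y (just (w₁ , a)) (just (w₂ , b))
  ¬Inner-cross {x = suc _} {suc _} w₁≢w₂ (refl , refl , _) = w₁≢w₂ refl

  module _ {n p} (Q : Packing N (Fin n) (Fin p)) where
    Covered : Fin n → Fin n → Set
    Covered w w′ = ∃ λ b → Edge (route Q b) w w′

    Covered? : ∀ w w′ → Dec (Covered w w′)
    Covered? w w′ = any? λ b → Edge? (route Q b) w w′

    Covered-sym : ∀ {w w′} → Covered w w′ → Covered w′ w
    Covered-sym (b , e) = b , Edge-sym e

    -- The order selects one orientation of each pair of groups, so that each bipartite graph is
    -- decomposed only once.
    IsFree : Fin n × Fin n → Set
    IsFree (w , w′) = w Fin.< w′ × ¬ Covered w w′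

    FreePair : Set
    FreePair = Refinement (Fin n × Fin n) IsFree

    Index : Set
    Index = (Fin n × Fin (suc t)) ⊎ (FreePair × Fin s) ⊎ (Fin p × Fin s × Fin s)

    abstract
      Index-finite : Finite Index
      Index-finite = (Fin-finite ×-finite Fin-finite) ⊎-finite ((FreePair-finite ×-finite Fin-finite)
        ⊎-finite (Fin-finite ×-finite (Fin-finite ×-finite Fin-finite)))
        where
        FreePair-finite : Finite FreePair
        FreePair-finite = filter-finite (Fin-finite ×-finite Fin-finite)
          λ (w , w′) → (w Fin.<? w′) ×-dec ¬? (Covered? w w′)

    transversal : Fin p → Fin s → Fin s → Fin N → Fin n × Fin s
    transversal b x y i = route Q b i , alt (toℕ i) x y

    walk : Index → Fin N → Vertex n
    walk (inj₁ (w , r))                   = embed w ∘ ham (toℕ r)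
    walk (inj₂ (inj₁ (((w , w′) , _) , x))) = just ∘ bip w w′ x
    walk (inj₂ (inj₂ (b , x , y)))        = just ∘ transversal b x y

    walk-injective : ∀ j → Injective _≡_ _≡_ (walk j)
    walk-injective (inj₁ (w , r)) = ham-injective (toℕ r) ∘ embed-injective
    walk-injective (inj₂ (inj₁ (((w , w′) , [ free ]) , x))) =
      bip-injective w w′ (λ { refl → ⊥-elim-irr (<-irrefl refl (proj₁ free)) }) x ∘ just-injective
    walk-injective (inj₂ (inj₂ (b , x , y))) = simple Q b ∘ cong proj₁ ∘ just-injective

    -- In crossing, i is the position of w on the route b.
    data Owner : Index → Vertex n → Vertex n → Set where
      inner    : ∀ {w r x y u v} → Inner w x y u v → toℕ r ≡ index x y → Owner (inj₁ (w , r)) u v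
      forward  : ∀ {w w′ free a b} → Owner (inj₂ (inj₁ (((w , w′) , free) , start w w′ a b)))
                                           (just (w , a)) (just (w′ , b))
      backward : ∀ {w w′ free a b} → Owner (inj₂ (inj₁ (((w , w′) , free) , start w w′ a b)))
                                           (just (w′ , b)) (just (w , a))
      crossing : ∀ {b x y w w′ α β i} → Edge (route Q b) w w′ → route Q b i ≡ w →
                 alt (toℕ i) x y ≡ α → alt (toℕ i) y x ≡ β →
                 Owner (inj₂ (inj₂ (b , x , y))) (just (w , α)) (just (w′ , β))

    owner : ∀ j {u v} → Edge (walk j) u v → Owner j u v
    owner (inj₁ (w , r)) e@(i , j , i⋖j , inj₁ (refl , refl)) = inner
      (refl , refl , Edge-irrefl (walk-injective (inj₁ (w , r))) e)
      (ham-sound (toℕ<n r) (i , j , i⋖j , inj₁ (refl , refl)))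
    owner (inj₁ (w , r)) e@(i , j , i⋖j , inj₂ (refl , refl)) = inner
      (refl , refl , Edge-irrefl (walk-injective (inj₁ (w , r))) e)
      (ham-sound (toℕ<n r) (i , j , i⋖j , inj₂ (refl , refl)))
    owner (inj₂ (inj₁ (((w , w′) , _) , x))) e with Edge-just e
    ... | _ , _ , refl , refl , e′ with bip-sound w w′ e′
    ... | a , b , inj₁ (refl , refl) , refl = forward
    ... | a , b , inj₂ (refl , refl) , refl = backward
    owner (inj₂ (inj₂ (b , x , y))) (i , j , i⋖j , inj₁ (refl , refl)) =
      crossing {i = i} (i , j , i⋖j , inj₁ (refl , refl)) refl refl (sym (cong (λ p → alt p x y) i⋖j))
    owner (inj₂ (inj₂ (b , x , y))) (i , j , i⋖j , inj₂ (refl , refl)) =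
      crossing {i = j} (i , j , i⋖j , inj₂ (refl , refl)) refl refl (cong (λ p → alt p y x) i⋖j)

    distinct-groups : ∀ {w w′} → .(IsFree (w , w′)) → w ≢ w′
    distinct-groups free refl = ⊥-elim-irr (<-irrefl refl (proj₁ free))

    -- Owners of different kinds never meet: inner edges do not join two groups, free pairs lie on
    -- no route, and their order forbids reading them both ways. Two crossings share the route by
    -- disjointness, then the position by simplicity, and then x and y by `alt-alt`.
    owner-unique : ∀ {j j′ u v} → Owner j u v → Owner j′ u v → j ≡ j′
    owner-unique (inner in₁ r≡) (inner in₂ r≡′) with Inner-unique in₁ in₂
    ... | refl , refl , refl = cong (λ r → inj₁ (_ , r)) (toℕ-injective (trans r≡ (sym r≡′)))
    owner-unique (inner in₁ _) (forward {free = [ free ]}) =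
      contradiction in₁ (¬Inner-cross (distinct-groups free))
    owner-unique (inner in₁ _) (backward {free = [ free ]}) =
      contradiction in₁ (¬Inner-cross (≢-sym (distinct-groups free)))
    owner-unique (inner in₁ _) (crossing {b = b} e _ _ _) =
      contradiction in₁ (¬Inner-cross (Edge-irrefl (simple Q b) e))
    owner-unique (forward {free = [ free ]}) (inner in₁ _) =
      contradiction in₁ (¬Inner-cross (distinct-groups free))
    owner-unique (backward {free = [ free ]}) (inner in₁ _) =
      contradiction in₁ (¬Inner-cross (≢-sym (distinct-groups free)))
    owner-unique (crossing {b = b} e _ _ _) (inner in₁ _) =
      contradiction in₁ (¬Inner-cross (Edge-irrefl (simple Q b) e))
    owner-unique forward forward = refl
    owner-unique backward backward = refl
    owner-unique (forward {free = [ free ]}) (backward {free = [ free′ ]}) =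
      ⊥-elim-irr (<-asym (proj₁ free) (proj₁ free′))
    owner-unique (backward {free = [ free ]}) (forward {free = [ free′ ]}) =
      ⊥-elim-irr (<-asym (proj₁ free) (proj₁ free′))
    owner-unique (forward {free = [ free ]}) (crossing e _ _ _) = ⊥-elim-irr (proj₂ free (_ , e))
    owner-unique (crossing e _ _ _) (forward {free = [ free ]}) = ⊥-elim-irr (proj₂ free (_ , e))
    owner-unique (backward {free = [ free ]}) (crossing e _ _ _) = ⊥-elim-irr (proj₂ free (_ , Edge-sym e))
    owner-unique (crossing e _ _ _) (backward {free = [ free ]}) = ⊥-elim-irr (proj₂ free (_ , Edge-sym e))
    owner-unique (crossing {b = b} {i = i} e i≡ p q) (crossing e′ i′≡ p′ q′) with disjoint Q e e′
    ... | refl with simple Q b (trans i≡ (sym i′≡))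
    ... | refl = cong₂ (λ x y → inj₂ (inj₂ (b , x , y)))
      (trans (sym (alt-alt (toℕ i))) (trans (cong₂ (alt (toℕ i)) (trans p (sym p′)) (trans q (sym q′))) (alt-alt (toℕ i))))
      (trans (sym (alt-alt (toℕ i))) (trans (cong₂ (alt (toℕ i)) (trans q (sym q′)) (trans p (sym p′))) (alt-alt (toℕ i))))

    inner-edge : ∀ w {x y} → x ≢ y → ∃ λ j → Edge (walk j) (embed w x) (embed w y)
    inner-edge w {x} {y} x≢y = inj₁ (w , fromℕ< (index< x y)) ,
      subst (λ r → Edge (embed w ∘ ham r) (embed w x) (embed w y)) (sym (toℕ-fromℕ< (index< x y)))
        (Edge-cong (embed w) (ham-complete x≢y))

    -- Applying the involution `alt q` to the prescribed coordinates yields the x and y whose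
    -- transversal shows them at positions q and q + 1.
    crossing-edge : ∀ {w w′} b → Edge (route Q b) w w′ → ∀ α β → ∃ λ j → Edge (walk j) (just (w , α)) (just (w′ , β))
    crossing-edge b (i , j , i⋖j , inj₁ (refl , refl)) α β =
      inj₂ (inj₂ (b , alt q α β , alt q β α)) , i , j , i⋖j ,
      inj₁ (cong (λ c → just (_ , c)) (alt-alt q) ,
            cong (λ c → just (_ , c)) (trans (cong (λ r → alt r (alt q α β) (alt q β α)) i⋖j) (alt-alt q)))
      where
      q : ℕ
      q = toℕ i
    -- Here w′ precedes w on the route, so α and β change places.
    crossing-edge b (i , j , i⋖j , inj₂ (refl , refl)) α β =
      inj₂ (inj₂ (b , alt q β α , alt q α β)) , i , j , i⋖j ,
      inj₂ (cong (λ c → just (_ , c)) (alt-alt q) ,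
            cong (λ c → just (_ , c)) (trans (cong (λ r → alt r (alt q β α) (alt q α β)) i⋖j) (alt-alt q)))
      where
      q : ℕ
      q = toℕ i

    free-edge : ∀ {w w′} → IsFree (w , w′) → ∀ a b → ∃ λ j → Edge (walk j) (just (w , a)) (just (w′ , b))
    free-edge {w} {w′} free a b = inj₂ (inj₁ (((w , w′) , [ free ]) , start w w′ a b)) ,
      Edge-cong just (bip-complete w w′ a b)

    cross-edge : ∀ {w w′} → w ≢ w′ → ∀ a b → ∃ λ j → Edge (walk j) (just (w , a)) (just (w′ , b))
    cross-edge {w} {w′} w≢w′ a b with Covered? w w′
    ... | yes (i , e) = crossing-edge i e a b
    ... | no free with Fin.<-cmp w w′
    ... | tri< w<w′ _ _ = free-edge (w<w′ , free) a b
    ... | tri≈ _ w≡w′ _ = contradiction w≡w′ w≢w′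
    ... | tri> _ _ w′<w = Product.map id Edge-sym (free-edge (w′<w , free ∘ Covered-sym) b a)

    edge : ∀ u v → u ≢ v → ∃ λ j → Edge (walk j) u v
    edge nothing nothing u≢v = contradiction refl u≢v
    edge nothing (just (w , b)) u≢v = inner-edge w {zero} {suc b} λ ()
    edge (just (w , a)) nothing u≢v = inner-edge w {suc a} {zero} λ ()
    edge (just (w , a)) (just (w′ , b)) u≢v with w Fin.≟ w′
    ... | yes refl = inner-edge w {suc a} {suc b} λ { refl → u≢v refl }
    ... | no w≢w′ = cross-edge w≢w′ a b

    walk-partition : ∀ u v → u ≢ v → ∃! _≡_ λ j → Edge (walk j) u v
    walk-partition u v u≢v with edge u v u≢v
    ... | j , e = j , e , λ {j′} e′ → owner-unique (owner j e) (owner j′ e′)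

-- Colourings of the completed system and removal of a route.

HasColouring-mono : ∀ {V B : Set} {l} {f : B → Fin (suc m) → V} → k ≤ l → HasColouring k f → HasColouring l f
HasColouring-mono {f = f} k≤l (colour , proper) = (λ v → inject≤ (colour v) k≤l) , λ b (c , mono) →
  proper b (colour (f b zero) , λ i → inject≤-injective k≤l k≤l _ _ (trans (mono i) (sym (mono zero))))

tail : ∀ {m n p} → Packing m (Fin n) (Fin (suc p)) → Packing m (Fin n) (Fin p)
tail Q = record
  { route = route Q ∘ suc ; simple = simple Q ∘ suc ; disjoint = λ e e′ → Fin.suc-injective (disjoint Q e e′) }

module _ (t : ℕ) where
  open Completion t
  open HamiltonianPaths t using (N; ham)
  open BipartitePaths t using (s; bip)

  walk-colouring⇒ : ∀ {n p k} (Q : Packing N (Fin n) (Fin p)) → HasColouring k (walk Q) → HasColouring k (route Q)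
  walk-colouring⇒ Q (colour , proper) = (λ w → colour (just (w , zero))) , λ b (c , mono) →
    proper (inj₂ (inj₂ (b , zero , zero)))
      (c , λ i → trans (cong (λ a → colour (just (route Q b i , a))) (alt-const (toℕ i) zero)) (mono i))

  not-in-group : ∀ {n} (w : Fin n) (f : Fin N → Vertex n) → Injective _≡_ _≡_ f → ¬ (∀ i → ∃ λ a → f i ≡ just (w , a))
  not-in-group w f f-inj inside = <⇒notInjective {f = proj₁ ∘ inside} (n<1+n s)
    λ {i} {j} eq → f-inj (trans (proj₂ (inside i)) (trans (cong (λ a → just (w , a)) eq) (sym (proj₂ (inside j)))))

  module _ {n p k} (Q : Packing N (Fin n) (Fin (suc p))) (colour : Vertex n → Fin k) where
    group : Fin n
    group = route Q zero zero

    recolour : Vertex n → Fin (suc k)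
    recolour nothing = suc (colour nothing)
    recolour (just (w , a)) with w Fin.≟ group
    ... | yes _ = zero
    ... | no _  = suc (colour (just (w , a)))

    recolour-zero : ∀ v → recolour v ≡ zero → ∃ λ a → v ≡ just (group , a)
    recolour-zero (just (w , a)) eq with w Fin.≟ group
    ... | yes refl = a , refl

    recolour-suc : ∀ v {c} → recolour v ≡ suc c → colour v ≡ c
    recolour-suc nothing refl = refl
    recolour-suc (just (w , a)) eq with w Fin.≟ group
    recolour-suc (just (w , a)) refl | no _ = refl

    recolour-group : ∀ a → recolour (just (group , a)) ≡ zero
    recolour-group a with group Fin.≟ group
    ... | yes _ = refl
    ... | no ¬refl = contradiction refl ¬refl

    -- Removing a route keeps every free pair free, so the only paths of the larger system that may
    -- be lost are the transversals of the removed route, and these start in `group`.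
    old-walk : ∀ j → (∃ λ j′ → ∀ i → walk (tail Q) j′ i ≡ walk Q j i) ⊎ (∃ λ a → walk Q j zero ≡ just (group , a))
    old-walk (inj₁ j)                          = inj₁ (inj₁ j , λ _ → refl)
    old-walk (inj₂ (inj₁ (free , x)))          =
      inj₁ (inj₂ (inj₁ (refine (Product.map id (_∘ Product.map suc id)) free , x)) , λ _ → refl)
    old-walk (inj₂ (inj₂ (zero , x , y)))      = inj₂ (x , refl)
    old-walk (inj₂ (inj₂ (suc b , x , y)))     = inj₁ (inj₂ (inj₂ (b , x , y)) , λ _ → refl)

    -- Colour zero is confined to a single group, too small for a path. In any other colour, a
    -- surviving path would have been monochromatic before, and a lost one starts with a vertex of
    -- colour zero.
    recolour-proper : (∀ j → ¬ Mono colour (walk (tail Q) j)) → ∀ j → ¬ Mono recolour (walk Q j)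
    recolour-proper proper j (zero , mono) =
      not-in-group group (walk Q j) (walk-injective Q j) (λ i → recolour-zero _ (mono i))
    recolour-proper proper j (suc c , mono) with old-walk j
    ... | inj₁ (j′ , same) = proper j′ (c , λ i → trans (cong colour (same i)) (recolour-suc _ (mono i)))
    ... | inj₂ (a , start) = contradiction (trans (sym (recolour-group a)) (trans (cong recolour (sym start)) (mono zero))) λ ()

  add-path : ∀ {n p k} (Q : Packing N (Fin n) (Fin (suc p))) → HasColouring k (walk (tail Q)) → HasColouring (suc k) (walk Q)
  add-path Q (colour , proper) = recolour Q colour , recolour-proper Q colour proper

-- Two colours suffice when there are no routes.

module _ (t : ℕ) where
  open Completion (suc t)
  open HamiltonianPaths (suc t) using (N; ham; toℕ-ham-0; toℕ-ham-1)
  open BipartitePaths (suc t) using (s; bip)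
  open Cyclic (suc t * 2)

  bicolour : ℕ → Fin 2
  bicolour p = alt p zero (suc zero)

  bicolour-alternates : ∀ p → bicolour (suc p) ≢ bicolour p
  bicolour-alternates (suc p) eq = bicolour-alternates p (sym eq)

  -- The parity of the position under `embed`, where ∞ is 0 and a is a + 1.
  parity-colour : ∀ {n} → Vertex n → Fin 2
  parity-colour nothing        = bicolour 0
  parity-colour (just (w , a)) = bicolour (suc (toℕ a))

  parity-embed : ∀ {n} (w : Fin n) x → parity-colour (embed w x) ≡ bicolour (toℕ x)
  parity-embed w zero    = refl
  parity-embed w (suc a) = refl

  -- As s is odd, parity breaks at the wraparound. Going up from 0 and down from every other residue
  -- avoids it.
  step : ∀ x → (toℕ x ≡ 0 × toℕ (x ⊕ ι 1) ≡ 1) ⊎ (∃ λ q → toℕ x ≡ suc q × toℕ (x ⊝ ι 1) ≡ q)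
  step x with toℕ x | ι-toℕ x | toℕ<n x
  ... | zero  | refl | _ = inj₁ (refl , trans (cong toℕ (sym (ι-+ 0 1))) (toℕ-ι-< (s<s z<s)))
  ... | suc q | refl | 1+q< = inj₂ (q , refl , trans (cong toℕ x-1) (toℕ-ι-< (<-trans (n<1+n q) 1+q<)))
    where
    x-1 : ι (suc q) ⊝ ι 1 ≡ ι q
    x-1 = trans (cong (_⊝ ι 1) (trans (cong ι (+-comm 1 q)) (ι-+ q 1))) (//-rightDividesʳ (ι 1) (ι q))

  -- A Hamiltonian path starts with positions r and r + 1. A zigzag has second coordinates x, x - 1
  -- and x + 1 at positions 0, 2 and 3, and `step` selects one of the last two to compare with x.
  -- Position 3 exists because N ≥ 4, whence `suc t` in this module.
  empty-colouring : ∀ {n} (Q : Packing N (Fin n) (Fin 0)) → HasColouring 2 (walk Q)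
  empty-colouring Q = parity-colour , proper
    where
    proper : ∀ j → ¬ Mono parity-colour (walk Q j)
    proper (inj₁ (w , r)) (c , mono) = bicolour-alternates (toℕ r)
      (trans (colour-at (suc zero) (toℕ-ham-1 (toℕ<n r))) (sym (colour-at zero (toℕ-ham-0 (toℕ<n r)))))
      where
      colour-at : ∀ i {q} → toℕ (ham (toℕ r) i) ≡ q → bicolour q ≡ c
      colour-at i refl = trans (sym (parity-embed w (ham (toℕ r) i))) (mono i)
    proper (inj₂ (inj₁ (((w , w′) , _) , x))) (c , mono) = clash (step x)
      where
      colour-at : ∀ i {q} → toℕ (proj₂ (bip w w′ x i)) ≡ q → bicolour (suc q) ≡ c
      colour-at i refl = mono i
      clash : ¬ ((toℕ x ≡ 0 × toℕ (x ⊕ ι 1) ≡ 1) ⊎ (∃ λ q → toℕ x ≡ suc q × toℕ (x ⊝ ι 1) ≡ q))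
      clash (inj₁ (x≡0 , x+1≡1)) = bicolour-alternates 1
        (trans (colour-at (suc (suc (suc zero))) x+1≡1) (sym (colour-at zero (trans (cong toℕ (⊝-0 x)) x≡0))))
      clash (inj₂ (q , x≡1+q , x-1≡q)) = bicolour-alternates (suc q)
        (trans (colour-at zero (trans (cong toℕ (⊝-0 x)) x≡1+q)) (sym (colour-at (suc (suc zero)) x-1≡q)))

-- Transport of routes and colourings along bijections.

module Relabel {V V′ B B′ : Set} {m} (V↔ : V ↔ V′) (B↔ : B ↔ B′) (route : B → Fin m → V) where
  open Inverse V↔ using () renaming (to to toV; from to fromV; strictlyInverseˡ to toV∘fromV; strictlyInverseʳ to fromV∘toV)
  open Inverse B↔ using () renaming (to to toB; from to fromB; strictlyInverseʳ to fromB∘toB)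

  relabelled : B′ → Fin m → V′
  relabelled b = toV ∘ route (fromB b)

  relabelled-injective : (∀ b → Injective _≡_ _≡_ (route b)) → ∀ b → Injective _≡_ _≡_ (relabelled b)
  relabelled-injective inj b = inj (fromB b) ∘ Injection.injective (↔⇒↣ V↔)

  Edge⇒ : ∀ {b u v} → Edge (relabelled b) u v → Edge (route (fromB b)) (fromV u) (fromV v)
  Edge⇒ = Edge-≗ (λ i → fromV∘toV _) ∘ Edge-cong fromV

  Edge⇐ : ∀ {b u v} → Edge (route b) (fromV u) (fromV v) → Edge (relabelled (toB b)) u v
  Edge⇐ {b} {u} {v} e = subst₂ (Edge (relabelled (toB b))) (toV∘fromV u) (toV∘fromV v)
    (Edge-cong toV (subst (λ b → Edge (route b) (fromV u) (fromV v)) (sym (fromB∘toB b)) e))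

  colouring⇒ : ∀ {k} → HasColouring k route → HasColouring k relabelled
  colouring⇒ (colour , proper) = colour ∘ fromV , λ b (c , mono) →
    proper (fromB b) (c , λ i → trans (cong colour (sym (fromV∘toV _))) (mono i))

  colouring⇐ : ∀ {k} → HasColouring k relabelled → HasColouring k route
  colouring⇐ (colour , proper) = colour ∘ toV , λ b (c , mono) →
    proper (toB b) (c , subst (λ b → ∀ i → colour (toV (route b i)) ≡ c) (sym (fromB∘toB b)) mono)

relabel : ∀ {V V′ B B′ : Set} {m} → V ↔ V′ → B ↔ B′ → Packing m V B → Packing m V′ B′
relabel V↔ B↔ Q = record
  { route = relabelled
  ; simple = relabelled-injective (simple Q)
  ; disjoint = λ e e′ → Injection.injective (↔⇒↣ (↔-sym B↔)) (disjoint Q (Edge⇒ e) (Edge⇒ e′)) }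
  where open Relabel V↔ B↔ (route Q)

-- Exhaustive search over the k ^ n coded colourings; the descent below branches on the result.
colourable? : ∀ {m n} k (S : PathSystem m n) → Dec (Colourable k S)
colourable? {m} {n} k S = map′
  (λ (c , proper) → finToFun c , proper)
  (λ (colour , proper) → funToFin colour , λ b (c , mono) →
     proper b (c , λ i → trans (sym (finToFun-funToFin colour _)) (mono i)))
  (any? {n = k ^ n} λ c → all? λ b → ¬? (any? λ x → all? λ i → finToFun c (vertex (path S b) i) Fin.≟ x))

-- With at most one vertex there is no path on m > 1 distinct vertices, so a constant colouring by
-- `suc k` colours would be proper.
chromatic⇒order>1 : ∀ {m n k} → 1 < m → (S : PathSystem m n) → Chromatic (suc (suc k)) S → 1 < n
chromatic⇒order>1 {n = n} 1<m S (_ , ¬colourable) with 1 <? n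
... | yes 1<n = 1<n
... | no 1≮n = contradiction ((λ _ → zero) , λ b _ →
  <⇒notInjective (≤-<-trans (≮⇒≥ 1≮n) 1<m) (distinct (path S b))) ¬colourable

-- Descent to a system of the required chromatic number.

module _ (t : ℕ) where
  open Completion (suc t)
  open HamiltonianPaths (suc t) using (N)

  abstract
    Vertex-finite : ∀ n → Finite (Vertex n)
    Vertex-finite n = Maybe-finite (Fin-finite ×-finite Fin-finite)

  module _ {n p} (Q : Packing N (Fin n) (Fin p)) where
    open Relabel (proj₂ (Vertex-finite n)) (proj₂ (Index-finite Q)) (walk Q)

    system : PathSystem N (proj₁ (Vertex-finite n))
    system = record
      { size = proj₁ (Index-finite Q)
      ; path = λ b → record { vertex = relabelled b ; distinct = relabelled-injective (walk-injective Q) b }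
      ; partition = partition′ }
      where
      partition′ : ∀ u v → u ≢ v → ∃! _≡_ λ b → Edge (relabelled b) u v
      partition′ u v u≢v with walk-partition Q _ _ (u≢v ∘ Injection.injective (↔⇒↣ (↔-sym (proj₂ (Vertex-finite n)))))
      ... | j , e , unique = Inverse.to (proj₂ (Index-finite Q)) j , Edge⇐ e , λ e′ →
        trans (cong (Inverse.to (proj₂ (Index-finite Q))) (unique (Edge⇒ e′)))
              (Inverse.strictlyInverseˡ (proj₂ (Index-finite Q)) _)

    system-colouring⇒ : ∀ {k} → Colourable k system → HasColouring k (walk Q)
    system-colouring⇒ = colouring⇐

    system-colouring⇐ : ∀ {k} → HasColouring k (walk Q) → Colourable k system
    system-colouring⇐ = colouring⇒

  -- Induction on the number of routes, preserving non-colourability with `suc k` colours. Once a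
  -- removal would destroy it, `add-path` colours the current system with one more colour; with no
  -- routes left, two colours are enough.
  chromatic-system : ∀ {n} k p (Q : Packing N (Fin n) (Fin p)) → ¬ Colourable (suc k) (system Q) →
    ∃ λ n → Σ[ S ∈ PathSystem N n ] Chromatic (suc (suc k)) S
  chromatic-system k zero Q ¬colourable = _ , system Q ,
    system-colouring⇐ Q (HasColouring-mono (s≤s (s≤s z≤n)) (empty-colouring t Q)) , ¬colourable
  chromatic-system k (suc p) Q ¬colourable with colourable? (suc k) (system (tail Q))
  ... | yes colourable = _ , system Q ,
    system-colouring⇐ Q (add-path (suc t) Q (system-colouring⇒ (tail Q) colourable)) , ¬colourable
  ... | no ¬colourable′ = chromatic-system k p (tail Q) ¬colourable′

  exists-chromatic : ∀ k → ∃ λ n → n > 1 × (Σ[ S ∈ PathSystem N n ] Chromatic (suc (suc k)) S)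
  exists-chromatic k with uncolourable-packing N (suc k)
  ... | record { V-finite = _ , V↔ ; B-finite = _ , B↔ ; packing = Q ; uncolourable = ¬colouring }
    with chromatic-system k _ (relabel V↔ B↔ Q)
      (¬colouring ∘ colouring⇐ ∘ walk-colouring⇒ (suc t) _ ∘ system-colouring⇒ _)
      where open Relabel V↔ B↔ (route Q)
  ... | n , S , chromatic = n , chromatic⇒order>1 (s≤s (s≤s z≤n)) S chromatic , S , chromatic

corollary3p4 : ∀ (m k : ℕ) → 2 ∣ m → m ≥ 4 → k ≥ 2 →
    ∃[ n ] (n > 1 × (Σ[ S ∈ PathSystem m n ] Chromatic k S))
-- The quotient t + 2 is h, and its double reduces to the N belonging to `suc t`; quotients 0 and 1
-- contradict m ≥ 4.
corollary3p4 _ (suc (suc k)) (divides (suc (suc t)) refl) _ _ = exists-chromatic t k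
corollary3p4 _ _ (divides 1 refl) (s≤s (s≤s ())) _
corollary3p4 _ 1 _ _ (s≤s ())
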